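{- There exists a correct tiling of the plane by square tiles, and every correct tiling of the plane by square tiles is non-periodic, i.e. there is no nonzero vector $a$ such that translating the tiling by $a$ (together with all its colors and orientations) yields the same tiling.
   Context: Colors are red and green. An arrow is a segment carrying an orientation (one of its two directions) and a color. A square tile is a unit square divided by its two diagonals into four isosceles right triangles (with right angles at the center of the square), each triangle colored red or green, decorated as follows: each of the four sides of the square is an arrow (arbitrary orientation and color); one diagonal, called the axis of the tile, is a single arrow of one color going from a corner to the opposite corner; the two halves of the other diagonal are arrows pointing from their corners towards the center, one red and one green; for each of these two half-diagonal arrows, the triangle immediately to its left (as seen by someone moving along it towards the center) is red and the triangle immediately to its right is green. The set of tiles is closed under rotations by multiples of $90^\circ$ but tiles may not be reflected (there are $4096$ tiles up to translation). A correct tiling by square tiles is a covering of the whole plane by translated copies of such tiles with pairwise disjoint interiors satisfying: (1) tiles meet side to side (edge-to-edge), and shared sides have the same color and orientation in both tiles; (2) any two triangles (of the same or of adjacent tiles) sharing a side have different colors; (3) at every vertex $v$ of the tiling, the crossing at $v$ (the set of arrows — square sides and half-diagonals, the axis being regarded as two half-diagonal arrows with its color and orientation — that have $v$ as an endpoint, each entering or leaving $v$) is legal. A crossing is legal if it consists of eight arrows at consecutive angles of $45^\circ$ such that: two collinear arrows of the same color pass through $v$ in the same direction (one entering and one leaving $v$), forming the axis of the crossing; the two arrows perpendicular to the axis both enter $v$ and have different colors; the remaining four arrows (at $45^\circ$ to the axis) leave $v$; and for each of the two perpendicular entering arrows, of the two leaving arrows forming a $45^\circ$ angle with it, the one on the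 left (as seen by someone moving along the entering arrow towards $v$) is red and the one on the right is green. -}

module Defs where

open import Data.Bool using (Bool; true; false; not)
open import Data.Integer using (ℤ; _+_; _-_; 0ℤ; 1ℤ)
open import Data.Product using (Σ; _×_; _,_)
open import Data.Sum using (_⊎_)
open import Relation.Binary.PropositionalEquality using (_≡_; _≢_)
open import Relation.Nullary using (¬_)

data Color : Set where
  red green : Color

-- The four sides of a square tile (equivalently the four triangles,
-- each triangle being the one adjacent to that side).
data Side : Set where
  E N W S : Side

data Corner : Set where
  NE NW SW SE : Corner

opposite : Corner → Corner
opposite NE = SW
opposite NW = SE
opposite SW = NE
opposite SE = NW

sameCorner : Corner → Corner → Bool
sameCorner NE NE = true
sameCorner NW NW = true
sameCorner SW SW = true
sameCorner SE SE = true
sameCorner _  _  = false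

-- Triangle immediately to the LEFT of the half-diagonal going from corner c
-- to the center (as seen by someone moving towards the center).
leftTri : Corner → Side
leftTri NE = E
leftTri NW = N
leftTri SW = W
leftTri SE = S

rightTri : Corner → Side
rightTri NE = N
rightTri NW = W
rightTri SW = S
rightTri SE = E

data Dir : Set where
  dE dNE dN dNW dW dSW dS dSE : Dir

rot : Dir → Dir
rot dE  = dNE
rot dNE = dN
rot dN  = dNW
rot dNW = dW
rot dW  = dSW
rot dSW = dS
rot dS  = dSE
rot dSE = dE

rot⁻ : Dir → Dir
rot⁻ dE  = dSE
rot⁻ dNE = dE
rot⁻ dN  = dNE
rot⁻ dNW = dN
rot⁻ dW  = dNW
rot⁻ dSW = dW
rot⁻ dS  = dSW
rot⁻ dSE = dS

rot2 rot4 rot6 : Dir → Dir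
rot2 d = rot (rot d)
rot4 d = rot2 (rot2 d)
rot6 d = rot2 (rot4 d)

-- A side arrow: color and orientation.  'pos = true' means the arrow points
-- in the positive coordinate direction (east for horizontal sides N,S;
-- north for vertical sides E,W).
record SideArrow : Set where
  constructor sideArrow
  field
    col : Color
    pos : Bool

-- A decorated square tile, placed in the plane (rotations are already
-- accounted for: every placed configuration is one of the 4096 tiles).
record Tile : Set where
  constructor tile
  field
    sideE sideN sideW sideS : SideArrow
    axisStart  : Corner                   -- axis goes from axisStart to opposite axisStart
    axisColor  : Color
    redCorner  : Corner                   -- corner of the other diagonal whose half-diagonal is red
    triE triN triW triS : Color

open Tile public

side : Tile → Side → SideArrow
side t E = sideE t
side t N = sideN t
side t W = sideW t
side t S = sideS t

tri : Tile → Side → Color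
tri t E = triE t
tri t N = triN t
tri t W = triW t
tri t S = triS t

-- Constraints making a configuration one of the tiles described:
-- the red half-diagonal lies on the non-axis diagonal (the other half
-- being green), and for both half-diagonals of the non-axis diagonal the
-- triangle to the left is red and the one to the right is green.
ValidTile : Tile → Set
ValidTile t =
  (redCorner t ≢ axisStart t) × (redCorner t ≢ opposite (axisStart t)) ×
  (∀ c → c ≢ axisStart t → c ≢ opposite (axisStart t) →
     (tri t (leftTri c) ≡ red) × (tri t (rightTri c) ≡ green))

-- An arrow seen from a vertex: its color and whether it leaves the vertex.
record Arrow : Set where
  constructor arrow
  field
    acol   : Color
    leaves : Bool

open Arrow public

-- The half-diagonal arrow of tile t having corner c as an endpoint,
-- seen from that corner (the axis is regarded as two half-diagonals).
halfDiag : Tile → Corner → Arrow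
halfDiag t c with sameCorner c (axisStart t) | sameCorner c (opposite (axisStart t)) | sameCorner c (redCorner t)
... | true  | _     | _     = arrow (axisColor t) true
... | false | true  | _     = arrow (axisColor t) false
... | false | false | true  = arrow red true
... | false | false | false = arrow green true

-- A tiling: the tile whose lower-left corner is (x , y) occupies
-- [x, x+1] × [y, y+1].
Tiling : Set
Tiling = ℤ → ℤ → Tile

-- The crossing at the vertex (x , y): the arrow in each of the 8 directions.
-- Side arrows are read from one of the two tiles sharing the side (they
-- agree by condition (1)).
crossing : Tiling → ℤ → ℤ → Dir → Arrow
crossing τ x y dE  = arrow (SideArrow.col (sideS (τ x y))) (SideArrow.pos (sideS (τ x y)))
crossing τ x y dN  = arrow (SideArrow.col (sideW (τ x y))) (SideArrow.pos (sideW (τ x y)))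
crossing τ x y dW  = arrow (SideArrow.col (sideS (τ (x - 1ℤ) y))) (not (SideArrow.pos (sideS (τ (x - 1ℤ) y))))
crossing τ x y dS  = arrow (SideArrow.col (sideW (τ x (y - 1ℤ)))) (not (SideArrow.pos (sideW (τ x (y - 1ℤ)))))
crossing τ x y dNE = halfDiag (τ x y) SW
crossing τ x y dNW = halfDiag (τ (x - 1ℤ) y) SE
crossing τ x y dSW = halfDiag (τ (x - 1ℤ) (y - 1ℤ)) NE
crossing τ x y dSE = halfDiag (τ x (y - 1ℤ)) NW

LegalWithAxis : (Dir → Arrow) → Dir → Set
LegalWithAxis κ a =
  (acol (κ a) ≡ acol (κ (rot4 a))) × (leaves (κ a) ≢ leaves (κ (rot4 a))) ×
  (leaves (κ (rot2 a)) ≡ false) × (leaves (κ (rot6 a)) ≡ false) ×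
  (acol (κ (rot2 a)) ≢ acol (κ (rot6 a))) ×
  (leaves (κ (rot a)) ≡ true) × (leaves (κ (rot⁻ a)) ≡ true) ×
  (leaves (κ (rot (rot4 a))) ≡ true) × (leaves (κ (rot⁻ (rot4 a))) ≡ true) ×
  -- for each perpendicular entering arrow at direction p: the leaving arrow
  -- on its left (direction p - 45°) is red, the one on its right (p + 45°) green
  (∀ p → (p ≡ rot2 a) ⊎ (p ≡ rot6 a) →
     (acol (κ (rot⁻ p)) ≡ red) × (acol (κ (rot p)) ≡ green))

Legal : (Dir → Arrow) → Set
Legal κ = Σ Dir (LegalWithAxis κ)

Correct : Tiling → Set
Correct τ =
  (∀ x y → ValidTile (τ x y)) ×
  (∀ x y → sideE (τ x y) ≡ sideW (τ (x + 1ℤ) y)) ×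
  (∀ x y → sideN (τ x y) ≡ sideS (τ x (y + 1ℤ))) ×
  (∀ x y → (triE (τ x y) ≢ triN (τ x y)) × (triN (τ x y) ≢ triW (τ x y)) ×
           (triW (τ x y) ≢ triS (τ x y)) × (triS (τ x y) ≢ triE (τ x y))) ×
  (∀ x y → triE (τ x y) ≢ triW (τ (x + 1ℤ) y)) ×
  (∀ x y → triN (τ x y) ≢ triS (τ x (y + 1ℤ))) ×
  (∀ x y → Legal (crossing τ x y))

-- τ is periodic: invariant under translation by a nonzero vector (a , b).
-- (A translation preserving a tiling by unit squares maps the grid to itself,
-- so periods are integer vectors.)
Periodic : Tiling → Set
Periodic τ = Σ ℤ λ a → Σ ℤ λ b → ¬ (a ≡ 0ℤ × b ≡ 0ℤ) ×
  (∀ x y → τ (x + a) (y + b) ≡ τ x y)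

{-# OPTIONS --safe #-}
-- Condition (2) makes the directions of the axes alternate like a checkerboard, so all axes
-- run between vertices of one parity class, and at a vertex of the other class every diagonal
-- arrow leaves.  The axes cut the plane into larger squares, scaled by √2 and turned by 45°,
-- centered at the vertices of the second class; the legality of the crossing at such a center
-- says exactly that the larger square is a tile, and the larger tiles again form a correct
-- tiling.  A period preserves the checkerboard, hence is a period of the larger tiling, of
-- half the squared length: infinite descent excludes nonzero periods.
--
-- Conversely a correct tiling can be subdivided.  Two subdivisions, with the rotation undone,
-- replace every tile by a 2 × 2 block depending on that tile only, and preserve the crossings
-- at old vertices.  Iterating from four suitable tiles around the origin gives a fixed point,
-- a correct tiling of the plane.
module Submission where

open import Defs
open import Data.Bool using (Bool; true; false; not)
open import Data.Bool.Properties using (not-involutive)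
open import Data.Empty using (⊥-elim)
open import Data.Integer using (ℤ; +_; -[1+_]; _+_; _-_; _*_; 0ℤ; 1ℤ; -1ℤ; ∣_∣)
open import Data.Integer.Properties using (+-injective; ∣i∣≡0⇒i≡0; pos-*)
open import Data.Integer.Tactic.RingSolver using (solve-∀)
open import Data.Nat as ℕ using (ℕ; zero; suc; z≤n; s≤s; ⌊_/2⌋)
open import Data.Nat.Properties as ℕₚ using (n≡⌊n+n/2⌋; n≡⌈n+n/2⌉)
open import Data.Product using (Σ; _×_; _,_; proj₁; proj₂)
open import Data.Sum using (_⊎_; inj₁; inj₂; [_,_]′)
open import Function using (_∘_)
open import Relation.Binary.PropositionalEquality
open import Relation.Nullary using (¬_)

-- Arrows and colors

reverse : Arrow → Arrow
reverse (arrow c l) = arrow c (not l)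

reverse-involutive : ∀ α → reverse (reverse α) ≡ α
reverse-involutive (arrow c l) = cong (arrow c) (not-involutive l)

fromSide : SideArrow → Arrow
fromSide (sideArrow c p) = arrow c p

toSide : Arrow → SideArrow
toSide (arrow c l) = sideArrow c l

≢⇒≡ : ∀ {a b c : Color} → a ≢ b → b ≢ c → a ≡ c
≢⇒≡ {red}   {red}   {_}     p q = ⊥-elim (p refl)
≢⇒≡ {red}   {green} {red}   p q = refl
≢⇒≡ {red}   {green} {green} p q = ⊥-elim (q refl)
≢⇒≡ {green} {green} {_}     p q = ⊥-elim (p refl)
≢⇒≡ {green} {red}   {green} p q = refl
≢⇒≡ {green} {red}   {red}   p q = ⊥-elim (q refl)

-- Tiles by the direction of their axis

-- A rising axis joins SW and NE, a falling one SE and NW. The triangle colors are the ones forced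
-- by the rule at the two off-axis corners; written as equations they can be matched with `refl`.
Rising Falling : Tile → Set
Rising t =
  (axisStart t ≡ SW ⊎ axisStart t ≡ NE) × (redCorner t ≡ NW ⊎ redCorner t ≡ SE) ×
  (triE t ≡ green) × (triN t ≡ red) × (triW t ≡ green) × (triS t ≡ red)
Falling t =
  (axisStart t ≡ SE ⊎ axisStart t ≡ NW) × (redCorner t ≡ NE ⊎ redCorner t ≡ SW) ×
  (triE t ≡ red) × (triN t ≡ green) × (triW t ≡ red) × (triS t ≡ green)

rising-colors : ∀ t → Rising t → ∀ c → c ≢ SW → c ≢ NE → (tri t (leftTri c) ≡ red) × (tri t (rightTri c) ≡ green)
rising-colors t _                           SW p q = ⊥-elim (p refl)
rising-colors t _                           NE p q = ⊥-elim (q refl)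
rising-colors t (_ , _ , _ , hN , hW , _)   NW p q = hN , hW
rising-colors t (_ , _ , hE , _ , _ , hS)   SE p q = hS , hE

falling-colors : ∀ t → Falling t → ∀ c → c ≢ SE → c ≢ NW → (tri t (leftTri c) ≡ red) × (tri t (rightTri c) ≡ green)
falling-colors t _                          SE p q = ⊥-elim (p refl)
falling-colors t _                          NW p q = ⊥-elim (q refl)
falling-colors t (_ , _ , hE , hN , _ , _)  NE p q = hE , hN
falling-colors t (_ , _ , _ , _ , hW , hS)  SW p q = hW , hS

rising-valid : ∀ t → Rising t → ValidTile t
rising-valid t@(tile _ _ _ _ _ _ _ _ _ _ _) h@(inj₁ refl , inj₁ refl , _) = (λ ()) , (λ ()) , rising-colors t h
rising-valid t@(tile _ _ _ _ _ _ _ _ _ _ _) h@(inj₁ refl , inj₂ refl , _) = (λ ()) , (λ ()) , rising-colors t h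
rising-valid t@(tile _ _ _ _ _ _ _ _ _ _ _) h@(inj₂ refl , inj₁ refl , _) = (λ ()) , (λ ()) , λ c p q → rising-colors t h c q p
rising-valid t@(tile _ _ _ _ _ _ _ _ _ _ _) h@(inj₂ refl , inj₂ refl , _) = (λ ()) , (λ ()) , λ c p q → rising-colors t h c q p

falling-valid : ∀ t → Falling t → ValidTile t
falling-valid t@(tile _ _ _ _ _ _ _ _ _ _ _) h@(inj₁ refl , inj₁ refl , _) = (λ ()) , (λ ()) , falling-colors t h
falling-valid t@(tile _ _ _ _ _ _ _ _ _ _ _) h@(inj₁ refl , inj₂ refl , _) = (λ ()) , (λ ()) , falling-colors t h
falling-valid t@(tile _ _ _ _ _ _ _ _ _ _ _) h@(inj₂ refl , inj₁ refl , _) = (λ ()) , (λ ()) , λ c p q → falling-colors t h c q p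
falling-valid t@(tile _ _ _ _ _ _ _ _ _ _ _) h@(inj₂ refl , inj₂ refl , _) = (λ ()) , (λ ()) , λ c p q → falling-colors t h c q p

off-rising : ∀ {c} → c ≢ SW → c ≢ NE → c ≡ NW ⊎ c ≡ SE
off-rising {NW} p q = inj₁ refl
off-rising {SE} p q = inj₂ refl
off-rising {SW} p q = ⊥-elim (p refl)
off-rising {NE} p q = ⊥-elim (q refl)

off-falling : ∀ {c} → c ≢ SE → c ≢ NW → c ≡ NE ⊎ c ≡ SW
off-falling {NE} p q = inj₁ refl
off-falling {SW} p q = inj₂ refl
off-falling {SE} p q = ⊥-elim (p refl)
off-falling {NW} p q = ⊥-elim (q refl)

valid-cases : ∀ t → ValidTile t → Rising t ⊎ Falling t
valid-cases (tile _ _ _ _ SW _ _ _ _ _ _) (p , q , h) =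
  let (hN , hW) = h NW (λ ()) (λ ()) ; (hS , hE) = h SE (λ ()) (λ ())
  in inj₁ (inj₁ refl , off-rising p q , hE , hN , hW , hS)
valid-cases (tile _ _ _ _ NE _ _ _ _ _ _) (p , q , h) =
  let (hN , hW) = h NW (λ ()) (λ ()) ; (hS , hE) = h SE (λ ()) (λ ())
  in inj₁ (inj₂ refl , off-rising q p , hE , hN , hW , hS)
valid-cases (tile _ _ _ _ SE _ _ _ _ _ _) (p , q , h) =
  let (hE , hN) = h NE (λ ()) (λ ()) ; (hW , hS) = h SW (λ ()) (λ ())
  in inj₂ (inj₁ refl , off-falling p q , hE , hN , hW , hS)
valid-cases (tile _ _ _ _ NW _ _ _ _ _ _) (p , q , h) =
  let (hE , hN) = h NE (λ ()) (λ ()) ; (hW , hS) = h SW (λ ()) (λ ())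
  in inj₂ (inj₂ refl , off-falling q p , hE , hN , hW , hS)

Alternating : Tile → Set
Alternating t = (triE t ≢ triN t) × (triN t ≢ triW t) × (triW t ≢ triS t) × (triS t ≢ triE t)

valid-alternating : ∀ t → ValidTile t → Alternating t
valid-alternating t@(tile _ _ _ _ _ _ _ _ _ _ _) h with valid-cases t h
... | inj₁ (_ , _ , refl , refl , refl , refl) = (λ ()) , (λ ()) , (λ ()) , (λ ())
... | inj₂ (_ , _ , refl , refl , refl , refl) = (λ ()) , (λ ()) , (λ ()) , (λ ())

-- The axis is one arrow seen from its two ends, and the other two half-diagonals run from their
-- corners to the center.
rising-halfDiag : ∀ t → Rising t →
  (halfDiag t NE ≡ reverse (halfDiag t SW)) × (acol (halfDiag t SE) ≢ acol (halfDiag t NW)) ×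
  (leaves (halfDiag t NW) ≡ true) × (leaves (halfDiag t SE) ≡ true)
rising-halfDiag (tile _ _ _ _ _ _ _ _ _ _ _) (inj₁ refl , inj₁ refl , _) = refl , (λ ()) , refl , refl
rising-halfDiag (tile _ _ _ _ _ _ _ _ _ _ _) (inj₁ refl , inj₂ refl , _) = refl , (λ ()) , refl , refl
rising-halfDiag (tile _ _ _ _ _ _ _ _ _ _ _) (inj₂ refl , inj₁ refl , _) = refl , (λ ()) , refl , refl
rising-halfDiag (tile _ _ _ _ _ _ _ _ _ _ _) (inj₂ refl , inj₂ refl , _) = refl , (λ ()) , refl , refl

falling-halfDiag : ∀ t → Falling t →
  (halfDiag t NW ≡ reverse (halfDiag t SE)) × (acol (halfDiag t SW) ≢ acol (halfDiag t NE)) ×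
  (leaves (halfDiag t NE) ≡ true) × (leaves (halfDiag t SW) ≡ true)
falling-halfDiag (tile _ _ _ _ _ _ _ _ _ _ _) (inj₁ refl , inj₁ refl , _) = refl , (λ ()) , refl , refl
falling-halfDiag (tile _ _ _ _ _ _ _ _ _ _ _) (inj₁ refl , inj₂ refl , _) = refl , (λ ()) , refl , refl
falling-halfDiag (tile _ _ _ _ _ _ _ _ _ _ _) (inj₂ refl , inj₁ refl , _) = refl , (λ ()) , refl , refl
falling-halfDiag (tile _ _ _ _ _ _ _ _ _ _ _) (inj₂ refl , inj₂ refl , _) = refl , (λ ()) , refl , refl

-- Crossings

perpendicular : ∀ {P : Dir → Set} {a} → P (rot2 a) → P (rot6 a) → ∀ p → (p ≡ rot2 a) ⊎ (p ≡ rot6 a) → P p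
perpendicular h k _ (inj₁ refl) = h
perpendicular h k _ (inj₂ refl) = k

rot-rot⁻ : ∀ d → rot (rot⁻ d) ≡ d
rot-rot⁻ dE  = refl
rot-rot⁻ dNE = refl
rot-rot⁻ dN  = refl
rot-rot⁻ dNW = refl
rot-rot⁻ dW  = refl
rot-rot⁻ dSW = refl
rot-rot⁻ dS  = refl
rot-rot⁻ dSE = refl

rot⁻-rot : ∀ d → rot⁻ (rot d) ≡ d
rot⁻-rot dE  = refl
rot⁻-rot dNE = refl
rot⁻-rot dN  = refl
rot⁻-rot dNW = refl
rot⁻-rot dW  = refl
rot⁻-rot dSW = refl
rot⁻-rot dS  = refl
rot⁻-rot dSE = refl

legal-resp : ∀ {κ κ′} → (∀ d → κ′ d ≡ κ d) → Legal κ → Legal κ′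
legal-resp {κ} {κ′} eq (a , h₁ , h₂ , h₃ , h₄ , h₅ , h₆ , h₇ , h₈ , h₉ , h) =
  a , trans (c a) (trans h₁ (sym (c _))) , (λ e → h₂ (trans (sym (l a)) (trans e (l _)))) ,
  trans (l _) h₃ , trans (l _) h₄ , (λ e → h₅ (trans (sym (c _)) (trans e (c _)))) ,
  trans (l _) h₆ , trans (l _) h₇ , trans (l _) h₈ , trans (l _) h₉ ,
  λ p hp → trans (c _) (proj₁ (h p hp)) , trans (c _) (proj₂ (h p hp))
  where
  c : ∀ d → acol (κ′ d) ≡ acol (κ d)
  c d = cong acol (eq d)
  l : ∀ d → leaves (κ′ d) ≡ leaves (κ d)
  l d = cong leaves (eq d)

-- Legality does not depend on where angles are counted from. This absorbs the 45° between fine and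
-- coarse directions.
legal-rot : ∀ {κ} → Legal κ → Legal (κ ∘ rot)
legal-rot {κ} (a , h) = rot⁻ a , turn (rot⁻ a) (subst (LegalWithAxis κ) (sym (rot-rot⁻ a)) h)
  where
  turn : ∀ b → LegalWithAxis κ (rot b) → LegalWithAxis (κ ∘ rot) b
  turn b (h₁ , h₂ , h₃ , h₄ , h₅ , h₆ , h₇ , h₈ , h₉ , h) =
    h₁ , h₂ , h₃ , h₄ , h₅ , h₆ , trans (swap leaves b) h₇ , h₈ , trans (swap leaves (rot4 b)) h₉ ,
    λ p hp → let (r , g) = h (rot p) ([ inj₁ ∘ cong rot , inj₂ ∘ cong rot ]′ hp) in trans (swap acol p) r , g
    where
    -- Opposite turns cancel in either order, but on a variable direction this is not a computation.
    swap : ∀ {A : Set} (f : Arrow → A) d → f (κ (rot (rot⁻ d))) ≡ f (κ (rot⁻ (rot d)))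
    swap f d = cong (f ∘ κ) (trans (rot-rot⁻ d) (sym (rot⁻-rot d)))

-- The crossing as a function of its four tiles alone, so that legality can be carried between fine,
-- coarse and subdivided tilings.
around : Tile → Tile → Tile → Tile → Dir → Arrow
around ne nw sw se dE  = fromSide (sideS ne)
around ne nw sw se dN  = fromSide (sideW ne)
around ne nw sw se dW  = reverse (fromSide (sideS nw))
around ne nw sw se dS  = reverse (fromSide (sideW se))
around ne nw sw se dNE = halfDiag ne SW
around ne nw sw se dNW = halfDiag nw SE
around ne nw sw se dSW = halfDiag sw NE
around ne nw sw se dSE = halfDiag se NW

crossing-around : ∀ τ x y {ne nw sw se} →
  τ x y ≡ ne → τ (x - 1ℤ) y ≡ nw → τ (x - 1ℤ) (y - 1ℤ) ≡ sw → τ x (y - 1ℤ) ≡ se →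
  ∀ d → crossing τ x y d ≡ around ne nw sw se d
crossing-around τ x y refl refl refl refl dE  = refl
crossing-around τ x y refl refl refl refl dNE = refl
crossing-around τ x y refl refl refl refl dN  = refl
crossing-around τ x y refl refl refl refl dNW = refl
crossing-around τ x y refl refl refl refl dW  = refl
crossing-around τ x y refl refl refl refl dSW = refl
crossing-around τ x y refl refl refl refl dS  = refl
crossing-around τ x y refl refl refl refl dSE = refl

-- Composition of a correct tiling into a coarser one

pick : ∀ {A : Set} → Color → A → A → A
pick red   x y = x
pick green x y = y

-- Of the four sides of fine tiles meeting at the center of a coarse tile, exactly one leaves the
-- center, and it points to the end of the coarse axis.  Fine directions are coarse ones turned by
-- 45°, so that e, n, w, s lead to the coarse corners SE, NE, NW, SW.
frame : (e n w s : Arrow) → Corner × Color × Corner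
frame (arrow c true) n w s = NW , c , pick (acol n) NE SW
frame e (arrow c true) w s = SW , c , pick (acol e) SE NW
frame e n (arrow c true) s = SE , c , pick (acol n) NE SW
frame e n w (arrow c _)    = NE , c , pick (acol e) SE NW

assemble : (sE sN sW sS : SideArrow) (e n w s : Arrow) (tE tN tW tS : Color) → Tile
assemble sE sN sW sS e n w s tE tN tW tS =
  let (a , c , r) = frame e n w s in tile sE sN sW sS a c r tE tN tW tS

-- Each fine axis is a coarse side, read from the corner where leaving means the positive coarse
-- direction. A coarse triangle takes the color of the fine half-diagonal that bisects it.
compose : Tile → Tile → Tile → Tile → Tile
compose ne nw sw se = assemble
  (toSide (halfDiag ne SE)) (toSide (halfDiag nw SW)) (toSide (halfDiag sw SE)) (toSide (halfDiag se SW))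
  (κ dE) (κ dN) (κ dW) (κ dS) (acol (κ dNE)) (acol (κ dNW)) (acol (κ dSW)) (acol (κ dSE))
  where κ = around ne nw sw se

-- The fine sides are seen from the coarse center and the coarse half-diagonals from the corners,
-- hence `reverse`.
Assembled : Tile → (e n w s : Arrow) → Set
Assembled t e n w s = ValidTile t ×
  (halfDiag t SE ≡ reverse e) × (halfDiag t NE ≡ reverse n) ×
  (halfDiag t NW ≡ reverse w) × (halfDiag t SW ≡ reverse s)

module _ (sE sN sW sS : SideArrow) where

  -- A horizontal fine axis becomes a falling coarse one. Once contradictory colors and orientations
  -- are excluded, the direction of the axis and the place of the red half-diagonal leave four
  -- cases.
  horizontal : ∀ e n w s {tE tN tW tS} →
    acol e ≡ acol w → leaves e ≢ leaves w → leaves n ≡ false → leaves s ≡ false → acol n ≢ acol s →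
    (tE ≡ red) × (tN ≡ green) → (tW ≡ red) × (tS ≡ green) →
    Assembled (assemble sE sN sW sS e n w s tE tN tW tS) e n w s
  horizontal (arrow c true)  _ (arrow c true)  _ refl l _ _ _ _ _ = ⊥-elim (l refl)
  horizontal (arrow c false) _ (arrow c false) _ refl l _ _ _ _ _ = ⊥-elim (l refl)
  horizontal _ (arrow red _)   _ (arrow red _)   _ _ _ _ p _ _ = ⊥-elim (p refl)
  horizontal _ (arrow green _) _ (arrow green _) _ _ _ _ p _ _ = ⊥-elim (p refl)
  horizontal (arrow c true) (arrow red false) (arrow c false) (arrow green false) refl _ refl refl _ (refl , refl) (refl , refl) =
    falling-valid _ (inj₂ refl , inj₁ refl , refl , refl , refl , refl) , refl , refl , refl , refl
  horizontal (arrow c true) (arrow green false) (arrow c false) (arrow red false) refl _ refl refl _ (refl , refl) (refl , refl) =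
    falling-valid _ (inj₂ refl , inj₂ refl , refl , refl , refl , refl) , refl , refl , refl , refl
  horizontal (arrow c false) (arrow red false) (arrow c true) (arrow green false) refl _ refl refl _ (refl , refl) (refl , refl) =
    falling-valid _ (inj₁ refl , inj₁ refl , refl , refl , refl , refl) , refl , refl , refl , refl
  horizontal (arrow c false) (arrow green false) (arrow c true) (arrow red false) refl _ refl refl _ (refl , refl) (refl , refl) =
    falling-valid _ (inj₁ refl , inj₂ refl , refl , refl , refl , refl) , refl , refl , refl , refl

  vertical : ∀ e n w s {tE tN tW tS} →
    acol n ≡ acol s → leaves n ≢ leaves s → leaves w ≡ false → leaves e ≡ false → acol w ≢ acol e →
    (tN ≡ red) × (tW ≡ green) → (tS ≡ red) × (tE ≡ green) →
    Assembled (assemble sE sN sW sS e n w s tE tN tW tS) e n w s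
  vertical _ (arrow c true)  _ (arrow c true)  refl l _ _ _ _ _ = ⊥-elim (l refl)
  vertical _ (arrow c false) _ (arrow c false) refl l _ _ _ _ _ = ⊥-elim (l refl)
  vertical (arrow red _)   _ (arrow red _)   _ _ _ _ _ p _ _ = ⊥-elim (p refl)
  vertical (arrow green _) _ (arrow green _) _ _ _ _ _ p _ _ = ⊥-elim (p refl)
  vertical (arrow red false) (arrow c true) (arrow green false) (arrow c false) refl _ refl refl _ (refl , refl) (refl , refl) =
    rising-valid _ (inj₁ refl , inj₂ refl , refl , refl , refl , refl) , refl , refl , refl , refl
  vertical (arrow green false) (arrow c true) (arrow red false) (arrow c false) refl _ refl refl _ (refl , refl) (refl , refl) =
    rising-valid _ (inj₁ refl , inj₁ refl , refl , refl , refl , refl) , refl , refl , refl , refl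
  vertical (arrow red false) (arrow c false) (arrow green false) (arrow c true) refl _ refl refl _ (refl , refl) (refl , refl) =
    rising-valid _ (inj₂ refl , inj₂ refl , refl , refl , refl , refl) , refl , refl , refl , refl
  vertical (arrow green false) (arrow c false) (arrow red false) (arrow c true) refl _ refl refl _ (refl , refl) (refl , refl) =
    rising-valid _ (inj₂ refl , inj₁ refl , refl , refl , refl , refl) , refl , refl , refl , refl

  assembled : ∀ κ → Legal κ →
    leaves (κ dNE) ≡ true → leaves (κ dNW) ≡ true → leaves (κ dSW) ≡ true → leaves (κ dSE) ≡ true →
    Assembled (assemble sE sN sW sS (κ dE) (κ dN) (κ dW) (κ dS) (acol (κ dNE)) (acol (κ dNW)) (acol (κ dSW)) (acol (κ dSE)))
      (κ dE) (κ dN) (κ dW) (κ dS)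
  assembled κ (dE , h₁ , h₂ , h₃ , h₄ , h₅ , _ , _ , _ , _ , h) _ _ _ _ =
    horizontal _ _ _ _ h₁ h₂ h₃ h₄ h₅ (h dN (inj₁ refl)) (h dS (inj₂ refl))
  assembled κ (dW , h₁ , h₂ , h₃ , h₄ , h₅ , _ , _ , _ , _ , h) _ _ _ _ =
    horizontal _ _ _ _ (sym h₁) (≢-sym h₂) h₄ h₃ (≢-sym h₅) (h dN (inj₂ refl)) (h dS (inj₁ refl))
  assembled κ (dN , h₁ , h₂ , h₃ , h₄ , h₅ , _ , _ , _ , _ , h) _ _ _ _ =
    vertical _ _ _ _ h₁ h₂ h₃ h₄ h₅ (h dW (inj₁ refl)) (h dE (inj₂ refl))
  assembled κ (dS , h₁ , h₂ , h₃ , h₄ , h₅ , _ , _ , _ , _ , h) _ _ _ _ =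
    vertical _ _ _ _ (sym h₁) (≢-sym h₂) h₄ h₃ (≢-sym h₅) (h dW (inj₂ refl)) (h dE (inj₁ refl))
  -- A diagonal axis would enter on one side, but all four diagonal arrows leave.
  assembled κ (dNE , _ , h , _) ne nw sw se = ⊥-elim (h (trans ne (sym sw)))
  assembled κ (dNW , _ , h , _) ne nw sw se = ⊥-elim (h (trans nw (sym se)))
  assembled κ (dSW , _ , h , _) ne nw sw se = ⊥-elim (h (trans sw (sym ne)))
  assembled κ (dSE , _ , h , _) ne nw sw se = ⊥-elim (h (trans se (sym nw)))

-- The common vertex is an off-axis corner of all four tiles, so their diagonal arrows leave it.
composed : ∀ ne nw sw se → Falling ne → Rising nw → Falling sw → Rising se → Legal (around ne nw sw se) →
  let κ = around ne nw sw se in Assembled (compose ne nw sw se) (κ dE) (κ dN) (κ dW) (κ dS)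
composed ne nw sw se hne hnw hsw hse L =
  let (_ , _ , _ , l₁) = falling-halfDiag ne hne ; (_ , _ , _ , l₂) = rising-halfDiag nw hnw
      (_ , _ , l₃ , _) = falling-halfDiag sw hsw ; (_ , _ , l₄ , _) = rising-halfDiag se hse
  in assembled _ _ _ _ (around ne nw sw se) L l₁ l₂ l₃ l₄

-- Doubling on ℤ

x-1+1≡x : ∀ x → x - 1ℤ + 1ℤ ≡ x
x-1+1≡x = solve-∀

dblℕ : Bool → ℕ → ℕ
dblℕ false n = n ℕ.+ n
dblℕ true  n = suc (n ℕ.+ n)

-- dbl ε a is 2a or 2a + 1; on negative numbers the digits are those of the two's complement.
dbl : Bool → ℤ → ℤ
dbl ε (+ n)    = + dblℕ ε n
dbl ε -[1+ n ] = -[1+ dblℕ (not ε) n ]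

oddℕ : ℕ → Bool
oddℕ zero    = false
oddℕ (suc n) = not (oddℕ n)

bit : ℤ → Bool
bit (+ n)    = oddℕ n
bit -[1+ n ] = not (oddℕ n)

-- Rounded towards minus infinity, so that iteration ends at 0 or -1, according to the sign.
half : ℤ → ℤ
half (+ n)    = + ⌊ n /2⌋
half -[1+ n ] = -[1+ ⌊ n /2⌋ ]

dbl-false : ∀ a → dbl false a ≡ a + a
dbl-false (+ n)    = refl
dbl-false -[1+ n ] = refl

dbl-true : ∀ a → dbl true a ≡ 1ℤ + (a + a)
dbl-true (+ n)    = refl
dbl-true -[1+ n ] = refl

dblℕ-suc : ∀ ε n → dblℕ ε (suc n) ≡ suc (suc (dblℕ ε n))
dblℕ-suc false n = cong suc (ℕₚ.+-suc n n)
dblℕ-suc true  n = cong (suc ∘ suc) (ℕₚ.+-suc n n)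

dblℕ-odd-half : ∀ n → dblℕ (oddℕ n) ⌊ n /2⌋ ≡ n
dblℕ-odd-half zero          = refl
dblℕ-odd-half (suc zero)    = refl
dblℕ-odd-half (suc (suc n)) rewrite not-involutive (oddℕ n) =
  trans (dblℕ-suc (oddℕ n) ⌊ n /2⌋) (cong (suc ∘ suc) (dblℕ-odd-half n))

dbl-bit-half : ∀ x → dbl (bit x) (half x) ≡ x
dbl-bit-half (+ n)    = cong +_ (dblℕ-odd-half n)
dbl-bit-half -[1+ n ] rewrite not-involutive (oddℕ n) = cong -[1+_] (dblℕ-odd-half n)

oddℕ-dblℕ : ∀ ε n → oddℕ (dblℕ ε n) ≡ ε
oddℕ-dblℕ false zero = refl
oddℕ-dblℕ true  zero = refl
oddℕ-dblℕ ε (suc n) = trans (cong oddℕ (dblℕ-suc ε n)) (trans (not-involutive _) (oddℕ-dblℕ ε n))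

bit-dbl : ∀ ε a → bit (dbl ε a) ≡ ε
bit-dbl ε (+ n)    = oddℕ-dblℕ ε n
bit-dbl ε -[1+ n ] = trans (cong not (oddℕ-dblℕ (not ε) n)) (not-involutive ε)

half-dblℕ : ∀ ε n → ⌊ dblℕ ε n /2⌋ ≡ n
half-dblℕ false n = sym (n≡⌊n+n/2⌋ n)
half-dblℕ true  n = sym (n≡⌈n+n/2⌉ n)

half-dbl : ∀ ε a → half (dbl ε a) ≡ a
half-dbl ε (+ n)    = cong +_ (half-dblℕ ε n)
half-dbl ε -[1+ n ] = cong -[1+_] (half-dblℕ (not ε) n)

-- Aperiodicity

translation-constant : ∀ {A : Set} (g : ℤ → A) → (∀ x → g (x + 1ℤ) ≡ g x) → ∀ x → g x ≡ g 0ℤ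
translation-constant g h (+ zero)       = refl
translation-constant g h (+ suc n)      =
  trans (cong (g ∘ +_) (sym (ℕₚ.+-comm n 1))) (trans (h (+ n)) (translation-constant g h (+ n)))
translation-constant g h -[1+ zero ]    = sym (h -[1+ zero ])
translation-constant g h -[1+ suc n ]   = trans (sym (h -[1+ suc n ])) (translation-constant g h -[1+ n ])

module _ (τ : Tiling) (τ-correct : Correct τ) where

  private
    valid : ∀ x y → ValidTile (τ x y)
    valid = proj₁ τ-correct
    alternating : ∀ x y → Alternating (τ x y)
    alternating = proj₁ (proj₂ (proj₂ (proj₂ τ-correct)))
    E≢W : ∀ x y → triE (τ x y) ≢ triW (τ (x + 1ℤ) y)
    E≢W = proj₁ (proj₂ (proj₂ (proj₂ (proj₂ τ-correct))))
    N≢S : ∀ x y → triN (τ x y) ≢ triS (τ x (y + 1ℤ))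
    N≢S = proj₁ (proj₂ (proj₂ (proj₂ (proj₂ (proj₂ τ-correct)))))
    legal : ∀ x y → Legal (crossing τ x y)
    legal = proj₂ (proj₂ (proj₂ (proj₂ (proj₂ (proj₂ τ-correct)))))

  -- Two alternating colors make opposite triangles of a tile equal, so the change of color across
  -- the shared side carries over to the E triangles.
  triE-flips-x : ∀ x y → triE (τ x y) ≢ triE (τ (x + 1ℤ) y)
  triE-flips-x x y eq =
    let (E≢N , N≢W , _) = alternating (x + 1ℤ) y
    in E≢W x y (trans eq (≢⇒≡ E≢N N≢W))

  triE-flips-y : ∀ x y → triE (τ x y) ≢ triE (τ x (y + 1ℤ))
  triE-flips-y x y eq =
    let (E≢N , _) = alternating x y ; (_ , _ , _ , S≢E) = alternating x (y + 1ℤ)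
        E≡S = ≢⇒≡ E≢N (N≢S x y)
    in S≢E (trans (sym E≡S) eq)

  triE-diagonal : ∀ x y → triE (τ (x + 1ℤ) (y + 1ℤ)) ≡ triE (τ x y)
  triE-diagonal x y = sym (≢⇒≡ (triE-flips-x x y) (triE-flips-y (x + 1ℤ) y))

  triE-antidiagonal : ∀ x y → triE (τ (x - 1ℤ) (y + 1ℤ)) ≡ triE (τ x y)
  triE-antidiagonal x y = ≢⇒≡ (≢-sym (triE-flips-y (x - 1ℤ) y))
    (λ eq → triE-flips-x (x - 1ℤ) y (trans eq (cong (λ z → triE (τ z y)) (sym (x-1+1≡x x)))))

  -- The coarse vertex (u , v) is the fine vertex (u - v + s , u + v): multiplication by 1 + i,
  -- followed by the shift s that puts coarse vertices on the parity class met by the axes.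
  module Coarsening (s : ℤ) (origin : triE (τ (0ℤ - 0ℤ + s) (0ℤ + 0ℤ)) ≡ green) where

    -- The fine tiles whose axes are the south and the west side of the coarse tile (u , v).
    onH onV : ℤ → ℤ → Tile
    onH u v = τ (u - v + s) (u + v)
    onV u v = τ (u - v + s - 1ℤ) (u + v)

    -- Unit coarse steps are diagonal fine steps, which keep the color.
    onH-green : ∀ u v → triE (onH u v) ≡ green
    onH-green u v = trans (translation-constant (λ u → triE (onH u v)) stepᵤ u)
                   (trans (translation-constant (λ v → triE (onH 0ℤ v)) stepᵥ v) origin)
      where
      eqᵤ : ∀ u v s → (u + 1ℤ) - v + s ≡ (u - v + s) + 1ℤ
      eqᵤ = solve-∀
      eqᵤ′ : ∀ u v → (u + 1ℤ) + v ≡ (u + v) + 1ℤ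
      eqᵤ′ = solve-∀
      stepᵤ : ∀ u → triE (onH (u + 1ℤ) v) ≡ triE (onH u v)
      stepᵤ u = trans (cong triE (cong₂ τ (eqᵤ u v s) (eqᵤ′ u v))) (triE-diagonal _ _)
      eqᵥ : ∀ v s → 0ℤ - (v + 1ℤ) + s ≡ (0ℤ - v + s) - 1ℤ
      eqᵥ = solve-∀
      eqᵥ′ : ∀ v → 0ℤ + (v + 1ℤ) ≡ (0ℤ + v) + 1ℤ
      eqᵥ′ = solve-∀
      stepᵥ : ∀ v → triE (onH 0ℤ (v + 1ℤ)) ≡ triE (onH 0ℤ v)
      stepᵥ v = trans (cong triE (cong₂ τ (eqᵥ v s) (eqᵥ′ v))) (triE-antidiagonal _ _)

    onV-not-green : ∀ u v → triE (onV u v) ≢ green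
    onV-not-green u v eq = triE-flips-x _ _
      (trans eq (sym (trans (cong (λ x → triE (τ x (u + v))) (x-1+1≡x (u - v + s))) (onH-green u v))))

    onH-rising : ∀ u v → Rising (onH u v)
    onH-rising u v with valid-cases _ (valid (u - v + s) (u + v))
    ... | inj₁ h = h
    ... | inj₂ (_ , _ , isRed , _) with trans (sym isRed) (onH-green u v)
    ... | ()

    onV-falling : ∀ u v → Falling (onV u v)
    onV-falling u v with valid-cases _ (valid (u - v + s - 1ℤ) (u + v))
    ... | inj₁ (_ , _ , isGreen , _) = ⊥-elim (onV-not-green u v isGreen)
    ... | inj₂ h = h

    -- The four tiles around the fine vertex `(u - v + s , u + v + 1)`, the center of the coarse
    -- tile; each carries one coarse side.
    coarse : Tiling
    coarse u v = compose (onV (u + 1ℤ) v) (onH u (v + 1ℤ)) (onV u v) (onH u v)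

    legal-center : ∀ u v → Legal (around (onV (u + 1ℤ) v) (onH u (v + 1ℤ)) (onV u v) (onH u v))
    legal-center u v = legal-resp
      (λ d → sym (crossing-around τ (u - v + s) (u + v + 1ℤ)
        (cong₂ τ (x₁ u v s) (y₁ u v)) (cong₂ τ (x₂ u v s) (y₂ u v))
        (cong (τ _) (y₃ u v)) (cong (τ _) (y₃ u v)) d))
      (legal _ _)
      where
      x₁ : ∀ u v s → u - v + s ≡ (u + 1ℤ) - v + s - 1ℤ
      x₁ = solve-∀
      y₁ : ∀ u v → u + v + 1ℤ ≡ (u + 1ℤ) + v
      y₁ = solve-∀
      x₂ : ∀ u v s → u - v + s - 1ℤ ≡ u - (v + 1ℤ) + s
      x₂ = solve-∀
      y₂ : ∀ u v → u + v + 1ℤ ≡ u + (v + 1ℤ)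
      y₂ = solve-∀
      y₃ : ∀ u v → u + v + 1ℤ - 1ℤ ≡ u + v
      y₃ = solve-∀

    legal-corner : ∀ u v → Legal (around (onH u v) (onV u v) (onH (u - 1ℤ) v) (onV u (v - 1ℤ)))
    legal-corner u v = legal-resp
      (λ d → sym (crossing-around τ (u - v + s) (u + v) refl refl
        (cong₂ τ (x₁ u v s) (y₁ u v)) (cong₂ τ (x₂ u v s) (y₂ u v)) d))
      (legal _ _)
      where
      x₁ : ∀ u v s → u - v + s - 1ℤ ≡ (u - 1ℤ) - v + s
      x₁ = solve-∀
      y₁ : ∀ u v → u + v - 1ℤ ≡ (u - 1ℤ) + v
      y₁ = solve-∀
      x₂ : ∀ u v s → u - v + s ≡ u - (v - 1ℤ) + s - 1ℤ
      x₂ = solve-∀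
      y₂ : ∀ u v → u + v - 1ℤ ≡ u + (v - 1ℤ)
      y₂ = solve-∀

    coarse-composed : ∀ u v → let κ = around (onV (u + 1ℤ) v) (onH u (v + 1ℤ)) (onV u v) (onH u v)
      in Assembled (coarse u v) (κ dE) (κ dN) (κ dW) (κ dS)
    coarse-composed u v = composed _ _ _ _
      (onV-falling (u + 1ℤ) v) (onH-rising u (v + 1ℤ)) (onV-falling u v) (onH-rising u v) (legal-center u v)

    -- Coarse sides are fine axes, read from the far end in the directions `dW` and `dS`; coarse
    -- half-diagonals are fine sides, read from the coarse centers.
    coarse-crossing : ∀ u v d → crossing coarse u v d ≡ around (onH u v) (onV u v) (onH (u - 1ℤ) v) (onV u (v - 1ℤ)) (rot d)
    coarse-crossing u v dE = refl
    coarse-crossing u v dN = refl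
    coarse-crossing u v dW = sym (proj₁ (rising-halfDiag (onH (u - 1ℤ) v) (onH-rising (u - 1ℤ) v)))
    coarse-crossing u v dS = sym (proj₁ (falling-halfDiag (onV u (v - 1ℤ)) (onV-falling u (v - 1ℤ))))
    coarse-crossing u v dNE =
      let (_ , _ , _ , _ , sw) = coarse-composed u v in trans sw (reverse-involutive _)
    coarse-crossing u v dNW =
      let (_ , se , _) = coarse-composed (u - 1ℤ) v
      in trans se (cong (λ z → reverse (fromSide (sideS (onV z v)))) (x-1+1≡x u))
    coarse-crossing u v dSW =
      let (_ , _ , ne , _) = coarse-composed (u - 1ℤ) (v - 1ℤ)
      in trans ne (cong (λ z → reverse (fromSide (sideW (onV z (v - 1ℤ))))) (x-1+1≡x u))
    coarse-crossing u v dSE =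
      let (_ , _ , _ , nw , _) = coarse-composed u (v - 1ℤ)
      in trans nw (trans (reverse-involutive _) (cong (λ z → fromSide (sideS (onH u z))) (x-1+1≡x v)))

    coarse-correct : Correct coarse
    coarse-correct =
      -- Both coarse tiles at a side read it off the same fine tile.
      coarse-valid , (λ _ _ → refl) , (λ _ _ → refl) , (λ u v → valid-alternating _ (coarse-valid u v)) ,
      -- The triangles on the two sides of a coarse side are colored by the two off-axis halves in
      -- one fine tile, one red and one green.
      (λ u v → proj₁ (proj₂ (falling-halfDiag _ (onV-falling (u + 1ℤ) v)))) ,
      (λ u v → proj₁ (proj₂ (rising-halfDiag _ (onH-rising u (v + 1ℤ))))) ,
      (λ u v → legal-resp (coarse-crossing u v) (legal-rot (legal-corner u v)))
      where
      coarse-valid : ∀ u v → ValidTile (coarse u v)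
      coarse-valid u v = proj₁ (coarse-composed u v)

    -- Multiplication by 1 + i turns the coarse translation `(p , q)` into the fine translation
    -- `(p - q , p + q)`.
    coarse-period : ∀ p q → (∀ x y → τ (x + (p - q)) (y + (p + q)) ≡ τ x y) →
      ∀ u v → coarse (u + p) (v + q) ≡ coarse u v
    coarse-period p q per u v =
      cong₄ (trans (cong (λ z → onV z (v + q)) (comm u p)) (perV (u + 1ℤ) v))
            (trans (cong (onH (u + p)) (comm v q)) (perH u (v + 1ℤ)))
            (perV u v) (perH u v)
      where
      comm : ∀ u p → u + p + 1ℤ ≡ u + 1ℤ + p
      comm = solve-∀
      xH : ∀ u v s p q → (u + p) - (v + q) + s ≡ (u - v + s) + (p - q)
      xH = solve-∀
      xV : ∀ u v s p q → (u + p) - (v + q) + s - 1ℤ ≡ (u - v + s - 1ℤ) + (p - q)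
      xV = solve-∀
      yHV : ∀ u v p q → (u + p) + (v + q) ≡ (u + v) + (p + q)
      yHV = solve-∀
      perH : ∀ u v → onH (u + p) (v + q) ≡ onH u v
      perH u v = trans (cong₂ τ (xH u v s p q) (yHV u v p q)) (per _ _)
      perV : ∀ u v → onV (u + p) (v + q) ≡ onV u v
      perV u v = trans (cong₂ τ (xV u v s p q) (yHV u v p q)) (per _ _)
      cong₄ : ∀ {a a′ b b′ c c′ d d′} → a ≡ a′ → b ≡ b′ → c ≡ c′ → d ≡ d′ → compose a b c d ≡ compose a′ b′ c′ d′
      cong₄ refl refl refl refl = refl

    -- A period takes rising tiles to rising tiles, so `a` and `b` have equal parity; `p` and `q`
    -- are half of `b + a` and half of `b - a`.
    period-even : ∀ a b → (∀ x y → τ (x + a) (y + b) ≡ τ x y) →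
      Σ ℤ λ p → Σ ℤ λ q → (a ≡ p - q) × (b ≡ p + q)
    period-even a b per = cases (bit a) (bit b) (half a) (half b) (sym (dbl-bit-half a)) (sym (dbl-bit-half b))
      where
      far-green : triE (τ (0ℤ - 0ℤ + s + a) (0ℤ + 0ℤ + b)) ≡ green
      far-green = trans (cong triE (per _ _)) origin
      p₀ : ∀ a b → a + a ≡ (a + b) - (b - a)
      p₀ = solve-∀
      q₀ : ∀ a b → b + b ≡ (a + b) + (b - a)
      q₀ = solve-∀
      p₁ : ∀ a b → 1ℤ + (a + a) ≡ (a + b + 1ℤ) - (b - a)
      p₁ = solve-∀
      q₁ : ∀ a b → 1ℤ + (b + b) ≡ (a + b + 1ℤ) + (b - a)
      q₁ = solve-∀
      x₂ : ∀ a b s → 0ℤ - 0ℤ + s + (a + a) ≡ (a + b + 1ℤ) - (b - a) + s - 1ℤ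
      x₂ = solve-∀
      y₂ : ∀ a b → 0ℤ + 0ℤ + (1ℤ + (b + b)) ≡ (a + b + 1ℤ) + (b - a)
      y₂ = solve-∀
      x₃ : ∀ a b s → 0ℤ - 0ℤ + s + (1ℤ + (a + a)) ≡ (a + b + 1ℤ) - (b - a - 1ℤ) + s - 1ℤ
      x₃ = solve-∀
      y₃ : ∀ a b → 0ℤ + 0ℤ + (b + b) ≡ (a + b + 1ℤ) + (b - a - 1ℤ)
      y₃ = solve-∀
      cases : ∀ ε δ a′ b′ → a ≡ dbl ε a′ → b ≡ dbl δ b′ → Σ ℤ λ p → Σ ℤ λ q → (a ≡ p - q) × (b ≡ p + q)
      cases false false a′ b′ ea eb =
        a′ + b′ , b′ - a′ , trans ea (trans (dbl-false a′) (p₀ a′ b′)) , trans eb (trans (dbl-false b′) (q₀ a′ b′))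
      cases true true a′ b′ ea eb =
        a′ + b′ + 1ℤ , b′ - a′ , trans ea (trans (dbl-true a′) (p₁ a′ b′)) , trans eb (trans (dbl-true b′) (q₁ a′ b′))
      -- For odd `a + b` the translated tile is falling: it is `onV u v` with `u - v - 1 = a` and
      -- `u + v = b`.
      cases false true a′ b′ ea eb = ⊥-elim (onV-not-green (a′ + b′ + 1ℤ) (b′ - a′)
        (trans (cong triE (sym (cong₂ τ
          (trans (cong (_+_ (0ℤ - 0ℤ + s)) (trans ea (dbl-false a′))) (x₂ a′ b′ s))
          (trans (cong (_+_ (0ℤ + 0ℤ)) (trans eb (dbl-true b′))) (y₂ a′ b′))))) far-green))
      cases true false a′ b′ ea eb = ⊥-elim (onV-not-green (a′ + b′ + 1ℤ) (b′ - a′ - 1ℤ)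
        (trans (cong triE (sym (cong₂ τ
          (trans (cong (_+_ (0ℤ - 0ℤ + s)) (trans ea (dbl-true a′))) (x₃ a′ b′ s))
          (trans (cong (_+_ (0ℤ + 0ℤ)) (trans eb (dbl-false b′))) (y₃ a′ b′))))) far-green))

-- Squared length and infinite descent

norm² : ℤ → ℤ → ℕ
norm² a b = ∣ a ∣ ℕ.* ∣ a ∣ ℕ.+ ∣ b ∣ ℕ.* ∣ b ∣

norm²-ℤ : ∀ a b → + norm² a b ≡ a * a + b * b
norm²-ℤ a b = cong₂ _+_ (square a) (square b)
  where
  square : ∀ a → + (∣ a ∣ ℕ.* ∣ a ∣) ≡ a * a
  square (+ n)    = pos-* n n
  square -[1+ n ] = refl

-- The factor is the squared modulus of 1 + i. The identity is proved in ℤ, where subtraction is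
-- available.
norm²-rotate : ∀ p q → norm² (p - q) (p + q) ≡ norm² p q ℕ.+ norm² p q
norm²-rotate p q = +-injective
  (trans (norm²-ℤ (p - q) (p + q)) (trans (identity p q) (sym (cong₂ _+_ (norm²-ℤ p q) (norm²-ℤ p q)))))
  where
  identity : ∀ p q → (p - q) * (p - q) + (p + q) * (p + q) ≡ (p * p + q * q) + (p * p + q * q)
  identity = solve-∀

norm²≡0 : ∀ a b → norm² a b ≡ 0 → (a ≡ 0ℤ) × (b ≡ 0ℤ)
norm²≡0 a b h = root a (ℕₚ.m+n≡0⇒m≡0 _ h) , root b (ℕₚ.m+n≡0⇒n≡0 (∣ a ∣ ℕ.* ∣ a ∣) h)
  where
  root : ∀ a → ∣ a ∣ ℕ.* ∣ a ∣ ≡ 0 → a ≡ 0ℤ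
  root a h with ℕₚ.m*n≡0⇒m≡0∨n≡0 ∣ a ∣ h
  ... | inj₁ h′ = ∣i∣≡0⇒i≡0 h′
  ... | inj₂ h′ = ∣i∣≡0⇒i≡0 h′

m+m≤1+n⇒m≤n : ∀ m n → m ℕ.+ m ℕ.≤ suc n → m ℕ.≤ n
m+m≤1+n⇒m≤n zero    n h = z≤n
m+m≤1+n⇒m≤n (suc m) n (s≤s h) = ℕₚ.≤-trans (ℕₚ.m≤n+m (suc m) m) h

-- Induction on a bound for the squared length, with `τ` varying because the halved period belongs
-- to the coarser tiling.
descent : ∀ n τ → Correct τ → ∀ a b → norm² a b ℕ.≤ n →
  (∀ x y → τ (x + a) (y + b) ≡ τ x y) → (a ≡ 0ℤ) × (b ≡ 0ℤ)
descent zero τ τ-correct a b small per = norm²≡0 a b (ℕₚ.n≤0⇒n≡0 small)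
descent (suc n) τ τ-correct a b small per = choose (triE (τ 0ℤ 0ℤ)) refl
  where
  coarsen : ∀ s → triE (τ (0ℤ - 0ℤ + s) (0ℤ + 0ℤ)) ≡ green → (a ≡ 0ℤ) × (b ≡ 0ℤ)
  coarsen s origin = reduce (period-even a b per)
    where
    open Coarsening τ τ-correct s origin
    reduce : (Σ ℤ λ p → Σ ℤ λ q → (a ≡ p - q) × (b ≡ p + q)) → (a ≡ 0ℤ) × (b ≡ 0ℤ)
    reduce (p , q , ea , eb) =
      let (p≡0 , q≡0) = descent n coarse coarse-correct p q
            (m+m≤1+n⇒m≤n _ n (subst (ℕ._≤ suc n) (trans (cong₂ norm² ea eb) (norm²-rotate p q)) small))
            (coarse-period p q (subst₂ (λ a b → ∀ x y → τ (x + a) (y + b) ≡ τ x y) ea eb per))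
      in trans ea (cong₂ _-_ p≡0 q≡0) , trans eb (cong₂ _+_ p≡0 q≡0)
  choose : ∀ c → triE (τ 0ℤ 0ℤ) ≡ c → (a ≡ 0ℤ) × (b ≡ 0ℤ)
  -- Green `triE` marks rising tiles. If the tile at the origin is falling, its right neighbour is
  -- rising, whence the shift 1.
  choose green eq = coarsen 0ℤ eq
  choose red   eq = coarsen 1ℤ (≢⇒≡ (λ eq′ → triE-flips-x τ τ-correct 0ℤ 0ℤ (trans eq (sym eq′))) λ ())

aperiodic : ∀ τ → Correct τ → ¬ Periodic τ
aperiodic τ τ-correct (a , b , a,b≢0 , per) = a,b≢0 (descent (norm² a b) τ τ-correct a b ℕₚ.≤-refl per)

-- Substitution

corner : Bool → Bool → Corner
corner false false = SW
corner true  false = SE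
corner true  true  = NE
corner false true  = NW

axisFrom : Corner → Bool → Corner
axisFrom c true  = c
axisFrom c false = opposite c

-- The tile replacing the quarter of t at corner ε δ in the subdivision of t into 2 × 2 tiles
-- (two inverse composition steps): the half-diagonal there becomes its axis, and its two inner
-- sides run from the center of t to the midpoints of the sides of t, colored like the triangles
-- they cross.
quarter : Bool → Bool → Tile → Tile
quarter false false t = tile
  (sideArrow (triS t) false) (sideArrow (triW t) false) (sideW t) (sideS t)
  (axisFrom SW (leaves (halfDiag t SW))) (acol (halfDiag t SW)) NW green red green red
quarter true false t = tile
  (sideE t) (sideArrow (triE t) true) (sideArrow (triS t) false) (sideS t)
  (axisFrom SE (leaves (halfDiag t SE))) (acol (halfDiag t SE)) SW red green red green
quarter true true t = tile
  (sideE t) (sideN t) (sideArrow (triN t) true) (sideArrow (triE t) true)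
  (axisFrom NE (leaves (halfDiag t NE))) (acol (halfDiag t NE)) SE green red green red
quarter false true t = tile
  (sideArrow (triN t) true) (sideN t) (sideW t) (sideArrow (triW t) false)
  (axisFrom NW (leaves (halfDiag t NW))) (acol (halfDiag t NW)) NE red green red green

quarter-valid : ∀ ε δ t → ValidTile (quarter ε δ t)
quarter-valid false false t with halfDiag t SW
... | arrow _ true  = rising-valid _ (inj₁ refl , inj₁ refl , refl , refl , refl , refl)
... | arrow _ false = rising-valid _ (inj₂ refl , inj₁ refl , refl , refl , refl , refl)
quarter-valid true true t with halfDiag t NE
... | arrow _ true  = rising-valid _ (inj₂ refl , inj₂ refl , refl , refl , refl , refl)
... | arrow _ false = rising-valid _ (inj₁ refl , inj₂ refl , refl , refl , refl , refl)
quarter-valid true false t with halfDiag t SE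
... | arrow _ true  = falling-valid _ (inj₁ refl , inj₂ refl , refl , refl , refl , refl)
... | arrow _ false = falling-valid _ (inj₂ refl , inj₂ refl , refl , refl , refl , refl)
quarter-valid false true t with halfDiag t NW
... | arrow _ true  = falling-valid _ (inj₂ refl , inj₁ refl , refl , refl , refl , refl)
... | arrow _ false = falling-valid _ (inj₁ refl , inj₁ refl , refl , refl , refl , refl)

-- Proved together, since all four arrows compute once the arrow of `t` at the chosen corner is
-- split.
quarter-halfDiag : ∀ ε δ t → let q = quarter ε δ t in
  (halfDiag q (corner ε δ) ≡ halfDiag t (corner ε δ)) ×
  (halfDiag q (corner (not ε) (not δ)) ≡ reverse (halfDiag t (corner ε δ))) ×
  (halfDiag q (redCorner q) ≡ arrow red true) ×
  (halfDiag q (opposite (redCorner q)) ≡ arrow green true)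
quarter-halfDiag false false t with halfDiag t SW
... | arrow _ true  = refl , refl , refl , refl
... | arrow _ false = refl , refl , refl , refl
quarter-halfDiag true true t with halfDiag t NE
... | arrow _ true  = refl , refl , refl , refl
... | arrow _ false = refl , refl , refl , refl
quarter-halfDiag true false t with halfDiag t SE
... | arrow _ true  = refl , refl , refl , refl
... | arrow _ false = refl , refl , refl , refl
quarter-halfDiag false true t with halfDiag t NW
... | arrow _ true  = refl , refl , refl , refl
... | arrow _ false = refl , refl , refl , refl

quarter-corner : ∀ ε δ t → halfDiag (quarter ε δ t) (corner ε δ) ≡ halfDiag t (corner ε δ)
quarter-corner ε δ t = proj₁ (quarter-halfDiag ε δ t)

quarter-center : ∀ ε δ t → halfDiag (quarter ε δ t) (corner (not ε) (not δ)) ≡ reverse (halfDiag t (corner ε δ))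
quarter-center ε δ t = proj₁ (proj₂ (quarter-halfDiag ε δ t))

quarter-red : ∀ ε δ t → halfDiag (quarter ε δ t) (redCorner (quarter ε δ t)) ≡ arrow red true
quarter-red ε δ t = proj₁ (proj₂ (proj₂ (quarter-halfDiag ε δ t)))

quarter-green : ∀ ε δ t → halfDiag (quarter ε δ t) (opposite (redCorner (quarter ε δ t))) ≡ arrow green true
quarter-green ε δ t = proj₂ (proj₂ (proj₂ (quarter-halfDiag ε δ t)))

-- Crossings of a subdivided tiling

legal-old-vertex : ∀ ne nw sw se → Legal (around ne nw sw se) →
  Legal (around (quarter false false ne) (quarter true false nw) (quarter true true sw) (quarter false true se))
legal-old-vertex ne nw sw se = legal-resp λ where
  dE  → refl
  dNE → quarter-corner false false ne
  dN  → refl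
  dNW → quarter-corner true false nw
  dW  → refl
  dSW → quarter-corner true true sw
  dS  → refl
  dSE → quarter-corner false true se

centerArrows : Tile → Dir → Arrow
centerArrows t dE  = arrow (triE t) true
centerArrows t dN  = arrow (triN t) true
centerArrows t dW  = arrow (triW t) true
centerArrows t dS  = arrow (triS t) true
centerArrows t dNE = reverse (halfDiag t NE)
centerArrows t dNW = reverse (halfDiag t NW)
centerArrows t dSW = reverse (halfDiag t SW)
centerArrows t dSE = reverse (halfDiag t SE)

-- The tile axis is the axis of the crossing, and the rule for the triangles beside a half-diagonal
-- becomes the rule for the arrows beside an entering one.
legal-centerArrows : ∀ t → ValidTile t → Legal (centerArrows t)
legal-centerArrows t h with valid-cases t h
... | inj₁ h′ = rising t h′
  where
  rising : ∀ t → Rising t → Legal (centerArrows t)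
  rising (tile _ _ _ _ _ _ _ _ _ _ _) (inj₁ refl , inj₁ refl , refl , refl , refl , refl) =
    dNE , refl , (λ ()) , refl , refl , (λ ()) , refl , refl , refl , refl , perpendicular (refl , refl) (refl , refl)
  rising (tile _ _ _ _ _ _ _ _ _ _ _) (inj₁ refl , inj₂ refl , refl , refl , refl , refl) =
    dNE , refl , (λ ()) , refl , refl , (λ ()) , refl , refl , refl , refl , perpendicular (refl , refl) (refl , refl)
  rising (tile _ _ _ _ _ _ _ _ _ _ _) (inj₂ refl , inj₁ refl , refl , refl , refl , refl) =
    dNE , refl , (λ ()) , refl , refl , (λ ()) , refl , refl , refl , refl , perpendicular (refl , refl) (refl , refl)
  rising (tile _ _ _ _ _ _ _ _ _ _ _) (inj₂ refl , inj₂ refl , refl , refl , refl , refl) =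
    dNE , refl , (λ ()) , refl , refl , (λ ()) , refl , refl , refl , refl , perpendicular (refl , refl) (refl , refl)
... | inj₂ h′ = falling t h′
  where
  falling : ∀ t → Falling t → Legal (centerArrows t)
  falling (tile _ _ _ _ _ _ _ _ _ _ _) (inj₁ refl , inj₁ refl , refl , refl , refl , refl) =
    dNW , refl , (λ ()) , refl , refl , (λ ()) , refl , refl , refl , refl , perpendicular (refl , refl) (refl , refl)
  falling (tile _ _ _ _ _ _ _ _ _ _ _) (inj₁ refl , inj₂ refl , refl , refl , refl , refl) =
    dNW , refl , (λ ()) , refl , refl , (λ ()) , refl , refl , refl , refl , perpendicular (refl , refl) (refl , refl)
  falling (tile _ _ _ _ _ _ _ _ _ _ _) (inj₂ refl , inj₁ refl , refl , refl , refl , refl) =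
    dNW , refl , (λ ()) , refl , refl , (λ ()) , refl , refl , refl , refl , perpendicular (refl , refl) (refl , refl)
  falling (tile _ _ _ _ _ _ _ _ _ _ _) (inj₂ refl , inj₂ refl , refl , refl , refl , refl) =
    dNW , refl , (λ ()) , refl , refl , (λ ()) , refl , refl , refl , refl , perpendicular (refl , refl) (refl , refl)

legal-tile-center : ∀ t → ValidTile t →
  Legal (around (quarter true true t) (quarter false true t) (quarter false false t) (quarter true false t))
legal-tile-center t h = legal-resp (λ where
    dE  → refl
    dNE → quarter-center true true t
    dN  → refl
    dNW → quarter-center false true t
    dW  → refl
    dSW → quarter-center false false t
    dS  → refl
    dSE → quarter-center true false t)
  (legal-centerArrows t h)

not-≢ : ∀ b → b ≢ not b
not-≢ true  ()
not-≢ false ()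

-- The old side runs straight through its midpoint and is the axis; the inner sides of the two
-- adjacent tiles enter with the colors of the triangles at that side, which differ.
legal-side-midpoint : ∀ κ a c l {c₁ c₂} → c₁ ≢ c₂ →
  κ a ≡ arrow c l → κ (rot4 a) ≡ arrow c (not l) →
  κ (rot2 a) ≡ arrow c₁ false → κ (rot6 a) ≡ arrow c₂ false →
  κ (rot a) ≡ arrow red true → κ (rot⁻ a) ≡ arrow green true →
  κ (rot (rot4 a)) ≡ arrow red true → κ (rot⁻ (rot4 a)) ≡ arrow green true → Legal κ
legal-side-midpoint κ a c l {c₁} {c₂} c₁≢c₂ a₀ a₄ a₂ a₆ a₁ a₇ a₅ a₃ =
  a , trans (cong acol a₀) (sym (cong acol a₄)) ,
  (λ eq → not-≢ l (trans (sym (cong leaves a₀)) (trans eq (cong leaves a₄)))) ,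
  cong leaves a₂ , cong leaves a₆ ,
  (λ eq → c₁≢c₂ (trans (sym (cong acol a₂)) (trans eq (cong acol a₆)))) ,
  cong leaves a₁ , cong leaves a₇ , cong leaves a₅ , cong leaves a₃ ,
  perpendicular
    (trans (cong (acol ∘ κ) (rot⁻-rot (rot a))) (cong acol a₁) ,
     trans (cong (acol ∘ κ) (sym (rot⁻-rot (rot (rot2 a))))) (cong acol a₃))
    (trans (cong (acol ∘ κ) (rot⁻-rot (rot (rot4 a)))) (cong acol a₅) ,
     trans (cong (acol ∘ κ) (full-turn a)) (cong acol a₇))
  where
  full-turn : ∀ d → rot (rot6 d) ≡ rot⁻ d
  full-turn dE  = refl
  full-turn dNE = refl
  full-turn dN  = refl
  full-turn dNW = refl
  full-turn dW  = refl
  full-turn dSW = refl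
  full-turn dS  = refl
  full-turn dSE = refl

legal-horizontal-midpoint : ∀ t b → triS t ≢ triN b →
  Legal (around (quarter true false t) (quarter false false t) (quarter false true b) (quarter true true b))
legal-horizontal-midpoint t b h = legal-side-midpoint _ dE _ _ h refl refl refl refl
  (quarter-red true false t) (quarter-green true true b) (quarter-red false true b) (quarter-green false false t)

legal-vertical-midpoint : ∀ t l → triE l ≢ triW t →
  Legal (around (quarter false true t) (quarter true true l) (quarter true false l) (quarter false false t))
legal-vertical-midpoint t l h = legal-side-midpoint _ dN _ _ h refl refl refl refl
  (quarter-red true true l) (quarter-green false true t) (quarter-red false false t) (quarter-green true false l)

-- A fixed point of the substitution

-- Around the origin: a legal crossing with a horizontal axis, completed to four tiles each of
-- which is its own quarter at the origin.
seed : ℤ → ℤ → Tile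
seed (+ _)    (+ _)    = tile
  (sideArrow red false) (sideArrow green false) (sideArrow red false) (sideArrow red true)
  SW red NW green red green red
seed -[1+ _ ] (+ _)    = tile
  (sideArrow red false) (sideArrow red true) (sideArrow green false) (sideArrow red true)
  SE green SW red green red green
seed -[1+ _ ] -[1+ _ ] = tile
  (sideArrow green true) (sideArrow red true) (sideArrow red true) (sideArrow green true)
  NE red SE green red green red
seed (+ _)    -[1+ _ ] = tile
  (sideArrow green true) (sideArrow red true) (sideArrow green true) (sideArrow red false)
  NW green NE red green red green

-- The seed subdivided `n` times; the last `n` binary digits of the coordinates address the nested
-- quarters.
approx : ℕ → Tiling
approx zero    x y = seed x y
approx (suc n) x y = quarter (bit x) (bit y) (approx n (half x) (half y))

-- The number of halvings needed to reach 0 or -1 is at most the size.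
size : ℤ → ℕ
size (+ n)    = n
size -[1+ n ] = n

size-half : ∀ x n → size x ℕ.≤ suc n → size (half x) ℕ.≤ n
size-half (+ m)    n h = halve m n h
  where
  halve : ∀ m n → m ℕ.≤ suc n → ⌊ m /2⌋ ℕ.≤ n
  halve zero          n h       = z≤n
  halve (suc m)       n (s≤s h) = ℕₚ.≤-trans (ℕₚ.≤-pred (ℕₚ.⌊n/2⌋<n m)) h
size-half -[1+ m ] n h = size-half (+ m) n h

size-dbl : ∀ ε a → size a ℕ.≤ size (dbl ε a)
size-dbl ε (+ n)    = lemma ε n
  where
  lemma : ∀ ε n → n ℕ.≤ dblℕ ε n
  lemma false n = ℕₚ.m≤m+n n n
  lemma true  n = ℕₚ.m≤n⇒m≤1+n (ℕₚ.m≤m+n n n)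
size-dbl ε -[1+ n ] = size-dbl (not ε) (+ n)

-- In the base case `half` fixes the coordinates 0 and -1, and each seed tile is its own quarter
-- there.
approx-stable-suc : ∀ n x y → size x ℕ.≤ n → size y ℕ.≤ n → approx (suc n) x y ≡ approx n x y
approx-stable-suc zero (+ zero)    (+ zero)    _ _ = refl
approx-stable-suc zero (+ zero)    -[1+ zero ] _ _ = refl
approx-stable-suc zero -[1+ zero ] (+ zero)    _ _ = refl
approx-stable-suc zero -[1+ zero ] -[1+ zero ] _ _ = refl
approx-stable-suc (suc n) x y hx hy =
  cong (quarter (bit x) (bit y)) (approx-stable-suc n (half x) (half y) (size-half x n hx) (size-half y n hy))

approx-stable : ∀ k n x y → size x ℕ.≤ n → size y ℕ.≤ n → approx (k ℕ.+ n) x y ≡ approx n x y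
approx-stable zero    n x y hx hy = refl
approx-stable (suc k) n x y hx hy =
  trans (approx-stable-suc (k ℕ.+ n) x y (ℕₚ.≤-trans hx (ℕₚ.m≤n+m n k)) (ℕₚ.≤-trans hy (ℕₚ.m≤n+m n k)))
        (approx-stable k n x y hx hy)

-- The limit of `approx`: this depth suffices for both coordinates.
tiling : Tiling
tiling x y = approx (size x ℕ.+ size y) x y

approx-tiling : ∀ n x y → size x ℕ.+ size y ℕ.≤ n → approx n x y ≡ tiling x y
approx-tiling n x y h =
  trans (cong (λ m → approx m x y) (sym (ℕₚ.m∸n+n≡m h)))
        (approx-stable (n ℕ.∸ (size x ℕ.+ size y)) _ x y (ℕₚ.m≤m+n (size x) (size y)) (ℕₚ.m≤n+m (size y) (size x)))

-- The fixed-point equation. Evaluating the left side one level deeper than necessary exposes a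
-- substitution step.
tiling-dbl : ∀ ε δ a b → tiling (dbl ε a) (dbl δ b) ≡ quarter ε δ (tiling a b)
tiling-dbl ε δ a b =
  trans (sym (approx-tiling (suc n) (dbl ε a) (dbl δ b) (ℕₚ.n≤1+n n)))
        (trans (cong₂ (λ x y → quarter (bit (dbl ε a)) (bit (dbl δ b)) (approx n x y)) (half-dbl ε a) (half-dbl δ b))
        (trans (cong₂ (λ ε δ → quarter ε δ (approx n a b)) (bit-dbl ε a) (bit-dbl δ b))
               (cong (quarter ε δ) (approx-tiling n a b (ℕₚ.+-mono-≤ (size-dbl ε a) (size-dbl δ b))))))
  where n = size (dbl ε a) ℕ.+ size (dbl δ b)

dbl-cases : (P : ℤ → ℤ → Set) → (∀ ε δ a b → P (dbl ε a) (dbl δ b)) → ∀ x y → P x y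
dbl-cases P h x y = subst₂ P (dbl-bit-half x) (dbl-bit-half y) (h (bit x) (bit y) (half x) (half y))

-- Repeated halving brings both coordinates to 0 or -1, which leaves four base cases.
dbl-induction : (P : ℤ → ℤ → Set) → P 0ℤ 0ℤ → P 0ℤ -1ℤ → P -1ℤ 0ℤ → P -1ℤ -1ℤ →
  (∀ ε δ a b → P a b → P (dbl ε a) (dbl δ b)) → ∀ x y → P x y
dbl-induction P h₁ h₂ h₃ h₄ step x y = go (size x ℕ.+ size y) x y (ℕₚ.m≤m+n _ _) (ℕₚ.m≤n+m _ _)
  where
  go : ∀ n x y → size x ℕ.≤ n → size y ℕ.≤ n → P x y
  go zero (+ zero)    (+ zero)    _ _ = h₁
  go zero (+ zero)    -[1+ zero ] _ _ = h₂
  go zero -[1+ zero ] (+ zero)    _ _ = h₃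
  go zero -[1+ zero ] -[1+ zero ] _ _ = h₄
  go (suc n) x y hx hy = subst₂ P (dbl-bit-half x) (dbl-bit-half y)
    (step (bit x) (bit y) (half x) (half y) (go n (half x) (half y) (size-half x n hx) (size-half y n hy)))

-- Carry and borrow: the halves of the two neighbours of `dbl ε a`.
next prev : Bool → ℤ → ℤ
next false a = a
next true  a = a + 1ℤ
prev false a = a - 1ℤ
prev true  a = a

dbl-next : ∀ ε a → dbl ε a + 1ℤ ≡ dbl (not ε) (next ε a)
dbl-next false a = trans (cong (_+ 1ℤ) (dbl-false a)) (trans (lemma a) (sym (dbl-true a)))
  where
  lemma : ∀ a → a + a + 1ℤ ≡ 1ℤ + (a + a)
  lemma = solve-∀
dbl-next true a = trans (cong (_+ 1ℤ) (dbl-true a)) (trans (lemma a) (sym (dbl-false (a + 1ℤ))))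
  where
  lemma : ∀ a → 1ℤ + (a + a) + 1ℤ ≡ a + 1ℤ + (a + 1ℤ)
  lemma = solve-∀

dbl-prev : ∀ ε a → dbl ε a - 1ℤ ≡ dbl (not ε) (prev ε a)
dbl-prev false a = trans (cong (_- 1ℤ) (dbl-false a)) (trans (lemma a) (sym (dbl-true (a - 1ℤ))))
  where
  lemma : ∀ a → a + a - 1ℤ ≡ 1ℤ + (a - 1ℤ + (a - 1ℤ))
  lemma = solve-∀
dbl-prev true a = trans (cong (_- 1ℤ) (dbl-true a)) (trans (lemma a) (sym (dbl-false a)))
  where
  lemma : ∀ a → 1ℤ + (a + a) - 1ℤ ≡ a + a
  lemma = solve-∀

tiling-next-x : ∀ ε δ a b → tiling (dbl ε a + 1ℤ) (dbl δ b) ≡ quarter (not ε) δ (tiling (next ε a) b)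
tiling-next-x ε δ a b = trans (cong (λ x → tiling x (dbl δ b)) (dbl-next ε a)) (tiling-dbl (not ε) δ (next ε a) b)

tiling-next-y : ∀ ε δ a b → tiling (dbl ε a) (dbl δ b + 1ℤ) ≡ quarter ε (not δ) (tiling a (next δ b))
tiling-next-y ε δ a b = trans (cong (tiling (dbl ε a)) (dbl-next δ b)) (tiling-dbl ε (not δ) a (next δ b))

-- Correctness of the fixed point

tiling-valid : ∀ x y → ValidTile (tiling x y)
tiling-valid = dbl-cases _ λ ε δ a b → subst ValidTile (sym (tiling-dbl ε δ a b)) (quarter-valid ε δ _)

-- The triangle colors of a quarter depend only on its position, so no induction is involved.
tiling-E≢W : ∀ x y → triE (tiling x y) ≢ triW (tiling (x + 1ℤ) y)
tiling-E≢W = dbl-cases _ λ ε δ a b →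
  subst₂ (λ t t′ → triE t ≢ triW t′) (sym (tiling-dbl ε δ a b)) (sym (tiling-next-x ε δ a b)) (quarters ε δ)
  where
  quarters : ∀ ε δ {t t′} → triE (quarter ε δ t) ≢ triW (quarter (not ε) δ t′)
  quarters false false ()
  quarters false true  ()
  quarters true  false ()
  quarters true  true  ()

tiling-N≢S : ∀ x y → triN (tiling x y) ≢ triS (tiling x (y + 1ℤ))
tiling-N≢S = dbl-cases _ λ ε δ a b →
  subst₂ (λ t t′ → triN t ≢ triS t′) (sym (tiling-dbl ε δ a b)) (sym (tiling-next-y ε δ a b)) (quarters ε δ)
  where
  quarters : ∀ ε δ {t t′} → triN (quarter ε δ t) ≢ triS (quarter ε (not δ) t′)
  quarters false false ()
  quarters false true  ()
  quarters true  false ()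
  quarters true  true  ()

-- An inner side is given identically by both quarters; a side lying on an old one inherits the
-- agreement.
tiling-sides-x : ∀ x y → sideE (tiling x y) ≡ sideW (tiling (x + 1ℤ) y)
tiling-sides-x = dbl-induction _ refl refl refl refl λ ε δ a b ih →
  subst₂ (λ t t′ → sideE t ≡ sideW t′) (sym (tiling-dbl ε δ a b)) (sym (tiling-next-x ε δ a b)) (quarters ε δ a b ih)
  where
  quarters : ∀ ε δ a b → sideE (tiling a b) ≡ sideW (tiling (a + 1ℤ) b) →
    sideE (quarter ε δ (tiling a b)) ≡ sideW (quarter (not ε) δ (tiling (next ε a) b))
  quarters false false a b ih = refl
  quarters false true  a b ih = refl
  quarters true  false a b ih = ih
  quarters true  true  a b ih = ih

tiling-sides-y : ∀ x y → sideN (tiling x y) ≡ sideS (tiling x (y + 1ℤ))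
tiling-sides-y = dbl-induction _ refl refl refl refl λ ε δ a b ih →
  subst₂ (λ t t′ → sideN t ≡ sideS t′) (sym (tiling-dbl ε δ a b)) (sym (tiling-next-y ε δ a b)) (quarters ε δ a b ih)
  where
  quarters : ∀ ε δ a b → sideN (tiling a b) ≡ sideS (tiling a (b + 1ℤ)) →
    sideN (quarter ε δ (tiling a b)) ≡ sideS (quarter ε (not δ) (tiling a (next δ b)))
  quarters false false a b ih = refl
  quarters true  false a b ih = refl
  quarters false true  a b ih = ih
  quarters true  true  a b ih = ih

tiling-legal : ∀ x y → Legal (crossing tiling x y)
tiling-legal = dbl-induction _
  -- The seed has a horizontal axis at the origin. The next two vertices are midpoints of a vertical
  -- and a horizontal old side, the last is the center of a rising tile.
  (dE  , refl , (λ ()) , refl , refl , (λ ()) , refl , refl , refl , refl , perpendicular (refl , refl) (refl , refl))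
  (dN  , refl , (λ ()) , refl , refl , (λ ()) , refl , refl , refl , refl , perpendicular (refl , refl) (refl , refl))
  (dE  , refl , (λ ()) , refl , refl , (λ ()) , refl , refl , refl , refl , perpendicular (refl , refl) (refl , refl))
  (dNE , refl , (λ ()) , refl , refl , (λ ()) , refl , refl , refl , refl , perpendicular (refl , refl) (refl , refl))
  λ ε δ a b ih → legal-resp
    (crossing-around tiling (dbl ε a) (dbl δ b) (tiling-dbl ε δ a b)
      (trans (cong (λ x → tiling x (dbl δ b)) (dbl-prev ε a)) (tiling-dbl (not ε) δ (prev ε a) b))
      (trans (cong₂ tiling (dbl-prev ε a) (dbl-prev δ b)) (tiling-dbl (not ε) (not δ) (prev ε a) (prev δ b)))
      (trans (cong (tiling (dbl ε a)) (dbl-prev δ b)) (tiling-dbl ε (not δ) a (prev δ b))))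
    (quarters ε δ a b ih)
  where
  quarters : ∀ ε δ a b → Legal (crossing tiling a b) →
    Legal (around (quarter ε δ (tiling a b)) (quarter (not ε) δ (tiling (prev ε a) b))
                  (quarter (not ε) (not δ) (tiling (prev ε a) (prev δ b))) (quarter ε (not δ) (tiling a (prev δ b))))
  -- The parities of the coordinates tell old vertices, tile centers and side midpoints apart; only
  -- old vertices use the induction hypothesis.
  quarters false false a b ih = legal-old-vertex _ _ _ _
    (legal-resp (λ d → sym (crossing-around tiling a b refl refl refl refl d)) ih)
  quarters true true a b ih = legal-tile-center (tiling a b) (tiling-valid a b)
  quarters true false a b ih = legal-horizontal-midpoint (tiling a b) (tiling a (b - 1ℤ))
    (subst (λ z → triS (tiling a z) ≢ triN (tiling a (b - 1ℤ))) (x-1+1≡x b) (≢-sym (tiling-N≢S a (b - 1ℤ))))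
  quarters false true a b ih = legal-vertical-midpoint (tiling a b) (tiling (a - 1ℤ) b)
    (subst (λ z → triE (tiling (a - 1ℤ) b) ≢ triW (tiling z b)) (x-1+1≡x a) (tiling-E≢W (a - 1ℤ) b))

tiling-correct : Correct tiling
tiling-correct =
  tiling-valid , tiling-sides-x , tiling-sides-y , (λ x y → valid-alternating _ (tiling-valid x y)) ,
  tiling-E≢W , tiling-N≢S , tiling-legal

theorem1 : Σ Tiling Correct × (∀ (τ : Tiling) → Correct τ → ¬ Periodic τ)
theorem1 = (tiling , tiling-correct) , aperiodic
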